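{- The class of multi-path matroids is closed under deletion: if $M$ is a multi-path matroid and $x$ is an element of $M$, then $M\backslash x$ is a multi-path matroid.
   Context: Transversal matroid $M[\mathcal{A}]$ of a multiset $\mathcal{A}=(A_j:j\in J)$ of subsets of a finite set $S$: independent sets are the sets $\{x_k:k\in K\}$ of $|K|$ distinct elements with $K\subseteq J$, $x_k\in A_k$; $\mathcal{A}$ is a presentation. For a cyclic permutation $\sigma$ of $S$, a $\sigma$-interval is a nonempty set $\{f,\sigma(f),\ldots,l\}$. A multi-path matroid is a transversal matroid with a presentation by an antichain (no member containing another) of $\sigma$-intervals for some cyclic permutation $\sigma$ of its ground set. -}

module Defs where

open import Data.Nat using (ℕ; zero; suc; _≤_)
open import Data.Fin using (Fin)
open import Data.Bool using (Bool; T)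
open import Data.Product using (Σ; ∃; _×_; _,_; proj₁)
open import Relation.Nullary using (¬_)
open import Relation.Nullary.Decidable using (False)
open import Relation.Binary.PropositionalEquality using (_≡_; _≢_)
open import Relation.Binary.Definitions using (DecidableEquality)
open import Function.Bundles using (_↔_; _⇔_; Inverse)

SubsetOf : Set → Set₁
SubsetOf E = E → Set

_⊆_ : {E : Set} → SubsetOf E → SubsetOf E → Set
A ⊆ B = ∀ e → A e → B e

Finite : Set → Set
Finite E = Σ ℕ λ n → E ↔ Fin n

iter : {E : Set} → (E → E) → ℕ → E → E
iter f zero    x = x
iter f (suc k) x = f (iter f k x)

record CyclicPerm (E : Set) : Set where
  field
    perm   : E ↔ E
    cyclic : ∀ a b → Σ ℕ λ k → iter (Inverse.to perm) k a ≡ b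

IsInterval : {E : Set} → CyclicPerm E → SubsetOf E → Set
IsInterval {E} σ I =
  Σ E λ f → Σ ℕ λ k → ∀ e →
    I e ⇔ (Σ ℕ λ i → i ≤ k × iter (Inverse.to (CyclicPerm.perm σ)) i f ≡ e)

IsAntichain : {E : Set} {m : ℕ} → (Fin m → SubsetOf E) → Set
IsAntichain A = ∀ i j → i ≢ j → ¬ (A i ⊆ A j)

TransInd : {E : Set} {m : ℕ} → (Fin m → SubsetOf E) → SubsetOf E → Set
TransInd {E} {m} A X =
  Σ (Fin m → Bool) λ K →
  Σ ((Σ (Fin m) λ k → T (K k)) → E) λ x →
    (∀ k l → x k ≡ x l → k ≡ l)
    × (∀ k → A (proj₁ k) (x k))
    × (∀ e → X e ⇔ (Σ (Σ (Fin m) λ k → T (K k)) λ k → x k ≡ e))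

-- A matroid on ground type E given by its independence predicate `Ind` is a
-- multi-path matroid if it equals M[A] for an antichain A of σ-intervals,
-- for some cyclic permutation σ of E.
IsMultiPath : (E : Set) → (SubsetOf E → Set) → Set₁
IsMultiPath E Ind =
  Σ (CyclicPerm E) λ σ →
  Σ ℕ λ m →
  Σ (Fin m → SubsetOf E) λ A →
    (∀ j → IsInterval σ (A j))
    × IsAntichain A
    × (∀ X → Ind X ⇔ TransInd A X)

Minus : (E : Set) → DecidableEquality E → E → Set
Minus E _≟_ x = Σ E λ y → False (y ≟ x)

Delete : (E : Set) (_≟_ : DecidableEquality E) → (SubsetOf E → Set) → (x : E)
       → SubsetOf (Minus E _≟_ x) → Set
Delete E _≟_ Ind x X = Ind (λ e → Σ (False (e ≟ x)) λ p → X (e , p))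

{-# OPTIONS --safe #-}
module Submission where

-- Passing from the cyclic order of E to that of E ∖ x turns the intervals of
-- the presentation into intervals (or ∅), but inclusions may appear. Whenever
-- a ∋ x becomes contained in c ∌ x, it still contains an end of c: c is an
-- interval next to x, and a passes through x. So the family satisfies
--   (*)  every nonempty member inside another one contains an end of it.
-- If A ⊆ B and r ∈ A, then B may be replaced by B ∖ r without changing the
-- transversal matroid. Applying this to a longest B that contains another
-- member, with r an end of B, keeps (*): a member D that comes to contain B ∖ r
-- either equals B (maximality) or misses r, and then D ends next to r.
-- Repeating this gives an antichain once the empty members are discarded.

open import Defs
open import Data.Bool using (Bool; true; false; T)
open import Data.Bool.Properties using (T-irrelevant)
open import Data.Empty using (⊥-elim)
open import Data.Fin using (Fin; zero; suc; punchIn; punchOut; fromℕ<; toℕ)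
open import Data.Fin.Permutation.Components using (transpose; transpose-inverse)
open import Data.Fin.Properties
  using (punchIn-injective; punchIn-punchOut; fromℕ<-injective; toℕ<n; toℕ-injective; injective⇒≤; any?)
  renaming (_≟_ to _≟ᶠ_)
open import Data.Maybe as Maybe using (Maybe; just; nothing; is-just)
open import Data.Maybe.Properties using (just-injective) renaming (≡-dec to Maybe-≡-dec)
open import Data.Nat using (ℕ; zero; suc; pred; _+_; _≤_; _<_; z≤n; s≤s; s≤s⁻¹; z<s; _<?_)
open import Data.Nat.Properties
open import Data.Product using (Σ; ∃; _×_; _,_; proj₁; proj₂)
open import Data.Sum using (_⊎_; inj₁; inj₂)
open import Data.Unit using (tt)
open import Data.Vec.Functional using (foldr; updateAt; insertAt)
open import Data.Vec.Functional.Properties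
  using (updateAt-updates; updateAt-minimal; insertAt-lookup; insertAt-punchIn)
open import Function using (_∘_; id; const)
open import Function.Bundles using (_⇔_; Inverse; Equivalence; mk⇔; mk↔ₛ′)
open import Function.Definitions using (Injective)
open import Function.Construct.Identity using (↔-id)
open import Function.Properties.Equivalence
  using () renaming (refl to ⇔-refl; sym to ⇔-sym; trans to ⇔-trans)
open import Relation.Binary.Definitions using (DecidableEquality; tri<; tri≈; tri>)
open import Relation.Binary.PropositionalEquality
open import Relation.Nullary using (¬_; Dec; yes; no; contradiction)
open import Relation.Nullary.Decidable using (False; toWitnessFalse; fromWitnessFalse; map′; decidable-stable; _×-dec_; ¬?)

open Equivalence using (to; from)

private variable
  E : Set
  m : ℕ

-- Transversal independence as partial matchings.

Match : (Fin m → SubsetOf E) → SubsetOf E → Set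
Match {m} {E} A X = Σ (Fin m → Maybe E) λ g →
  (∀ {k l e} → g k ≡ just e → g l ≡ just e → k ≡ l)
  × (∀ {k e} → g k ≡ just e → A k e)
  × (∀ e → X e ⇔ ∃ λ k → g k ≡ just e)

restrict : (b : Bool) → (T b → E) → Maybe E
restrict true  h = just (h tt)
restrict false h = nothing

restrict⁻ : ∀ b {h : T b → E} {e} → restrict b h ≡ just e → ∃ λ t → h t ≡ e
restrict⁻ true refl = tt , refl

restrict⁺ : ∀ b (h : T b → E) t → restrict b h ≡ just (h t)
restrict⁺ true h tt = refl

extract : (y : Maybe E) → T (is-just y) → E
extract (just e) _ = e

extract⁺ : {y : Maybe E} {e : E} → y ≡ just e → Σ (T (is-just y)) λ t → extract y t ≡ e
extract⁺ refl = tt , refl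

extract⁻ : (y : Maybe E) (t : T (is-just y)) → y ≡ just (extract y t)
extract⁻ (just e) _ = refl

-- Indices outside `K` become `nothing`. A total function into `Maybe E` can be composed with maps
-- of indices without transporting proofs of `T (K k)`.
TransInd⇔Match : (A : Fin m → SubsetOf E) (X : SubsetOf E) → TransInd A X ⇔ Match A X
TransInd⇔Match {m} {E} A X = mk⇔ ⇒ ⇐
  where
  ⇒ : TransInd A X → Match A X
  ⇒ (K , x , inj , mem , cov) = g , g-inj , g-mem , g-cov
    where
    g : Fin m → Maybe E
    g k = restrict (K k) (λ t → x (k , t))
    g-inj : ∀ {k l e} → g k ≡ just e → g l ≡ just e → k ≡ l
    g-inj {k} {l} p q with restrict⁻ (K k) p | restrict⁻ (K l) q
    ... | t , r | u , s = cong proj₁ (inj (k , t) (l , u) (trans r (sym s)))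
    g-mem : ∀ {k e} → g k ≡ just e → A k e
    g-mem {k} p with restrict⁻ (K k) p
    ... | t , refl = mem (k , t)
    g-cov : ∀ e → X e ⇔ ∃ λ k → g k ≡ just e
    g-cov e = mk⇔
      (λ Xe → let ((k , t) , p) = to (cov e) Xe in
              k , trans (restrict⁺ (K k) _ t) (cong just p))
      (λ (k , p) → let (t , q) = restrict⁻ (K k) p in from (cov e) ((k , t) , q))
  ⇐ : Match A X → TransInd A X
  ⇐ (g , inj , mem , cov) = is-just ∘ g , x , x-inj , x-mem , x-cov
    where
    x : (Σ (Fin m) λ k → T (is-just (g k))) → E
    x (k , t) = extract (g k) t
    x-inj : ∀ k l → x k ≡ x l → k ≡ l
    x-inj (k , t) (l , u) p
      with refl ← inj (extract⁻ (g k) t) (trans (extract⁻ (g l) u) (cong just (sym p)))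
      = cong (k ,_) (T-irrelevant t u)
    x-mem : ∀ k → A (proj₁ k) (x k)
    x-mem (k , t) = mem (extract⁻ (g k) t)
    x-cov : ∀ e → X e ⇔ ∃ λ k → x k ≡ e
    x-cov e = mk⇔
      (λ Xe → let (k , p) = to (cov e) Xe
                  (t , q) = extract⁺ p in (k , t) , q)
      (λ ((k , t) , q) → from (cov e) (k , trans (extract⁻ (g k) t) (cong just q)))

Match-mono : {A B : Fin m → SubsetOf E} {X : SubsetOf E} →
             (∀ k → A k ⊆ B k) → Match A X → Match B X
Match-mono A⊆B (g , inj , mem , cov) = g , inj , (λ p → A⊆B _ _ (mem p)) , cov

-- If r is matched to j, exchange what i and j are matched to.
Match-shrink : DecidableEquality E → {A B : Fin m → SubsetOf E} {i j : Fin m} {r : E} →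
               i ≢ j → B i ⊆ B j → B i r →
               (∀ k → A k ⊆ B k) → (∀ k e → B k e → k ≢ j ⊎ e ≢ r → A k e) →
               ∀ X → Match B X ⇔ Match A X
Match-shrink {E} {m} _≟_ {A} {B} {i} {j} {r} i≢j Bi⊆Bj Bir A⊆B B∖⊆A X =
  mk⇔ ⇒ (Match-mono A⊆B)
  where
  ⇒ : Match B X → Match A X
  ⇒ (g , inj , mem , cov) with Maybe-≡-dec _≟_ (g j) (just r)
  ... | no gj≢r = g , inj , mem′ , cov
    where
    mem′ : ∀ {k e} → g k ≡ just e → A k e
    mem′ {k} {e} p with k ≟ᶠ j
    ... | no k≢j   = B∖⊆A k e (mem p) (inj₁ k≢j)
    ... | yes refl = B∖⊆A k e (mem p) (inj₂ λ { refl → gj≢r p })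
  ... | yes gj≡r = g ∘ τ , inj′ , mem′ , cov′
    where
    τ : Fin m → Fin m
    τ = transpose i j
    inj′ : ∀ {k l e} → g (τ k) ≡ just e → g (τ l) ≡ just e → k ≡ l
    inj′ p q = trans (sym (transpose-inverse j i))
                     (trans (cong (transpose j i) (inj p q)) (transpose-inverse j i))
    mem′ : ∀ {k e} → g (τ k) ≡ just e → A k e
    mem′ {k} {e} p with k ≟ᶠ i
    ... | yes refl with refl ← just-injective (trans (sym gj≡r) p) = B∖⊆A i r Bir (inj₁ i≢j)
    mem′ {k} {e} p | no _ with k ≟ᶠ j
    ... | no k≢j = B∖⊆A k e (mem p) (inj₁ k≢j)
    -- Index `j` takes over the element of `i`, which lies in `B i`, hence in `B j`, and differs
    -- from `r` because `g` is injective.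
    ... | yes refl = B∖⊆A j e (Bi⊆Bj e (mem p)) (inj₂ λ { refl → i≢j (inj p gj≡r) })
    cov′ : ∀ e → X e ⇔ ∃ λ k → g (τ k) ≡ just e
    cov′ e = mk⇔
      (λ Xe → let (k , p) = to (cov e) Xe in
              transpose j i k , trans (cong g (transpose-inverse i j)) p)
      (λ (k , p) → from (cov e) (τ k , p))

Match-removeAt : (A : Fin (suc m) → SubsetOf E) (j : Fin (suc m)) → (∀ e → ¬ A j e) →
                 ∀ X → Match A X ⇔ Match (A ∘ punchIn j) X
Match-removeAt {m} {E} A j empty X = mk⇔ ⇒ ⇐
  where
  ⇒ : Match A X → Match (A ∘ punchIn j) X
  ⇒ (g , inj , mem , cov) =
    g ∘ punchIn j , (λ p q → punchIn-injective j _ _ (inj p q)) , mem ,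
    λ e → mk⇔ (λ Xe → cover (to (cov e) Xe)) (λ (k , p) → from (cov e) (_ , p))
    where
    cover : ∀ {e} → ∃ (λ k → g k ≡ just e) → ∃ λ k → g (punchIn j k) ≡ just e
    cover {e} (k , p) = punchOut j≢k , trans (cong g (punchIn-punchOut j≢k)) p
      where
      j≢k : j ≢ k
      j≢k refl = empty e (mem p)
  ⇐ : Match (A ∘ punchIn j) X → Match A X
  ⇐ (g , inj , mem , cov) = h , h-inj , h-mem , λ e → mk⇔
      (λ Xe → let (k , p) = to (cov e) Xe in
              punchIn j k , trans (insertAt-punchIn g j nothing k) p)
      (λ (k , p) → let (k′ , _ , q) = old k p in from (cov e) (k′ , q))
    where
    h : Fin (suc m) → Maybe E
    h = insertAt g j nothing
    old : ∀ k {e} → h k ≡ just e → ∃ λ k′ → k ≡ punchIn j k′ × g k′ ≡ just e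
    old k p with j ≟ᶠ k
    ... | yes refl = contradiction (trans (sym (insertAt-lookup g j nothing)) p) λ ()
    ... | no j≢k = punchOut j≢k , sym eq ,
                   trans (sym (insertAt-punchIn g j nothing _)) (trans (cong h eq) p)
      where eq = punchIn-punchOut j≢k
    h-inj : ∀ {k l e} → h k ≡ just e → h l ≡ just e → k ≡ l
    h-inj {k} {l} p q with old k p | old l q
    ... | _ , refl , p′ | _ , refl , q′ = cong (punchIn j) (inj p′ q′)
    h-mem : ∀ {k e} → h k ≡ just e → A k e
    h-mem {k} p with old k p
    ... | _ , refl , p′ = mem p′

-- Maxima and sums over finite families.

argmax : {P : Fin m → Set} → (∀ j → Dec (P j)) → (f : Fin m → ℕ) → ∃ P →
         ∃ λ j → P j × (∀ k → P k → f k ≤ f j)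
argmax {suc m} {P} P? f (j , Pj) with any? (P? ∘ suc)
... | no none = j , Pj , only j Pj
  where
  only : ∀ j → P j → ∀ k → P k → f k ≤ f j
  only zero    _  zero    _  = ≤-refl
  only (suc j) Pj _       _  = contradiction (j , Pj) none
  only _       _  (suc k) Pk = contradiction (k , Pk) none
... | yes some with argmax (P? ∘ suc) (f ∘ suc) some
...   | j′ , Pj′ , max with P? zero
...     | no ¬P0 = suc j′ , Pj′ , λ where
            zero    P0 → contradiction P0 ¬P0
            (suc k) Pk → max k Pk
...     | yes P0 with ≤-total (f zero) (f (suc j′))
...       | inj₁ f0≤ = suc j′ , Pj′ , λ where
              zero    _  → f0≤
              (suc k) Pk → max k Pk
...       | inj₂ ≤f0 = zero , P0 , λ where
              zero    _  → ≤-refl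
              (suc k) Pk → ≤-trans (max k Pk) ≤f0

sum : (Fin m → ℕ) → ℕ
sum = foldr _+_ 0

sum-mono-≤ : {f g : Fin m → ℕ} → (∀ k → f k ≤ g k) → sum f ≤ sum g
sum-mono-≤ {zero}  _   = z≤n
sum-mono-≤ {suc m} f≤g = +-mono-≤ (f≤g zero) (sum-mono-≤ (f≤g ∘ suc))

sum-mono-< : {f g : Fin m → ℕ} → (∀ k → f k ≤ g k) → ∀ j → f j < g j → sum f < sum g
sum-mono-< f≤g zero    f<g = +-mono-<-≤ f<g (sum-mono-≤ (f≤g ∘ suc))
sum-mono-< f≤g (suc j) f<g = +-mono-≤-< (f≤g zero) (sum-mono-< (f≤g ∘ suc) j f<g)

-- Arcs of an injective map and the reduction to an antichain.

iter-suc : (f : E → E) (k : ℕ) (x : E) → iter f (suc k) x ≡ iter f k (f x)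
iter-suc f zero    x = refl
iter-suc f (suc k) x = cong f (iter-suc f k x)

module Arcs {E : Set} (_≟_ : DecidableEquality E) (σ : E → E) (σ-inj : Injective _≡_ _≡_ σ) where

  -- A start and a number of elements, rather than the index of the last element as in `IsInterval`,
  -- so that length 0 encodes the empty set that deletion can produce.
  Arc : Set
  Arc = E × ℕ

  first : Arc → E
  first = proj₁

  len : Arc → ℕ
  len = proj₂

  -- For an arc of length 0 this is its (non-member) first.
  last : Arc → E
  last (f , k) = iter σ (pred k) f

  ⟦_⟧ : Arc → SubsetOf E
  ⟦ f , k ⟧ e = ∃ λ i → i < k × iter σ i f ≡ e

  -- Rules out winding around the cycle, so that `len` is the cardinality of the arc.
  Simple : Arc → Set
  Simple (f , k) = ∀ {i j} → i < j → j < k → iter σ i f ≢ iter σ j f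

  ⟦_⟧? : ∀ a e → Dec (⟦ a ⟧ e)
  ⟦ f , k ⟧? e = anyUpTo? (λ i → iter σ i f ≟ e) k

  _⊆?_ : ∀ a b → Dec (⟦ a ⟧ ⊆ ⟦ b ⟧)
  (f , k) ⊆? b = map′ (λ { h e (i , i<k , refl) → h i<k }) (λ h {i} i<k → h (iter σ i f) (i , i<k , refl))
                      (allUpTo? (λ i → ⟦ b ⟧? (iter σ i f)) k)

  first∈ : ∀ a → 0 < len a → ⟦ a ⟧ (first a)
  first∈ a 0<k = 0 , 0<k , refl

  occupied : ∀ a {e} → ⟦ a ⟧ e → 0 < len a
  occupied a (_ , i<k , _) = ≤-trans z<s i<k

  last∈ : ∀ a → 0 < len a → ⟦ a ⟧ (last a)
  last∈ (f , suc k) _ = k , ≤-refl , refl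

  leave-last : ∀ a {e} → ⟦ a ⟧ e → ¬ ⟦ a ⟧ (σ e) → e ≡ last a
  leave-last (f , suc k) (i , i<k , refl) ∉ with m≤n⇒m<n∨m≡n (s≤s⁻¹ i<k)
  ... | inj₁ i<k′ = contradiction (suc i , s≤s i<k′ , refl) ∉
  ... | inj₂ refl = refl

  -- If `σ e` had a positive position, injectivity of `σ` would put `e` at the position before it.
  enter-first : ∀ a {e} → ¬ ⟦ a ⟧ e → ⟦ a ⟧ (σ e) → σ e ≡ first a
  enter-first a ∉ (zero  , _   , p) = sym p
  enter-first a ∉ (suc i , i<k , p) = contradiction (i , <-trans ≤-refl i<k , σ-inj p) ∉

  -- Pigeonhole on the positions of the `h i` in the arc.
  size-≤ : ∀ a {n} (h : Fin n → E) → Injective _≡_ _≡_ h → (∀ i → ⟦ a ⟧ (h i)) → n ≤ len a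
  size-≤ (f , k) h h-inj h∈ = injective⇒≤ {f = λ i → fromℕ< (proj₁ (proj₂ (h∈ i)))} λ {i} {j} p →
    h-inj (trans (sym (proj₂ (proj₂ (h∈ i))))
          (trans (cong (λ n → iter σ n f) (fromℕ<-injective _ _ _ _ p)) (proj₂ (proj₂ (h∈ j)))))

  Simple-tail : ∀ f k → Simple (f , suc k) → Simple (σ f , k)
  Simple-tail f k simple {i} {j} i<j j<k p =
    simple (s≤s i<j) (s≤s j<k) (trans (iter-suc σ i f) (trans p (sym (iter-suc σ j f))))

  -- A positive position has a predecessor in the arc, and position 0 has a successor unless the
  -- length is 1.
  neighbours : ∀ a {x} → ⟦ a ⟧ x →
               ⟦ a ⟧ (σ x) ⊎ (∃ λ w → σ w ≡ x × ⟦ a ⟧ w) ⊎ (∀ e → ⟦ a ⟧ e → e ≡ x)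
  neighbours (f , suc k) (suc i , i<k , p) =
    inj₂ (inj₁ (iter σ i f , p , i , <-trans ≤-refl i<k , refl))
  neighbours (f , suc zero) (zero , _ , refl) = inj₂ (inj₂ λ { e (zero , _ , p) → sym p
                                                             ; e (suc _ , s≤s () , _) })
  neighbours (f , suc (suc k)) (zero , _ , refl) = inj₁ (1 , s≤s z<s , refl)

  Simple-injective : ∀ a → Simple a → ∀ {i j} → i < len a → j < len a →
                     iter σ i (first a) ≡ iter σ j (first a) → i ≡ j
  Simple-injective a simple {i} {j} i<k j<k p with <-cmp i j
  ... | tri< i<j _ _ = contradiction p (simple i<j j<k)
  ... | tri≈ _ i≡j _ = i≡j
  ... | tri> _ _ j<i = contradiction (sym p) (simple j<i i<k)

  -- An element of `b` outside `a`, added to the `len a` distinct elements of `a`, would make `b`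
  -- too large.
  ⊆-antisym-≤ : ∀ a b → Simple a → ⟦ a ⟧ ⊆ ⟦ b ⟧ → len b ≤ len a → ⟦ b ⟧ ⊆ ⟦ a ⟧
  ⊆-antisym-≤ a@(f , k) b simple a⊆b b≤a e e∈b with ⟦ a ⟧? e
  ... | yes e∈a = e∈a
  ... | no  e∉a = contradiction (≤-trans (size-≤ b h h-inj h∈) b≤a) 1+n≰n
    where
    h : Fin (suc k) → E
    h zero    = e
    h (suc i) = iter σ (toℕ i) f
    h-inj : Injective _≡_ _≡_ h
    h-inj {zero}  {zero}  p = refl
    h-inj {zero}  {suc j} p = contradiction (toℕ j , toℕ<n j , sym p) e∉a
    h-inj {suc i} {zero}  p = contradiction (toℕ i , toℕ<n i , p) e∉a
    h-inj {suc i} {suc j} p =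
      cong suc (toℕ-injective (Simple-injective a simple (toℕ<n i) (toℕ<n j) p))
    h∈ : ∀ i → ⟦ b ⟧ (h i)
    h∈ zero    = e∈b
    h∈ (suc i) = a⊆b _ (toℕ i , toℕ<n i , refl)

  -- The first repeated iterate closes up: the iterates before it form a simple arc that `σ` maps
  -- into itself.
  Simple-or-closed : ∀ f k → Simple (f , suc k) ⊎
    ∃ λ l → l < k × Simple (f , suc l) × (∀ {e} → ⟦ f , suc l ⟧ e → ⟦ f , suc l ⟧ (σ e))
  Simple-or-closed f zero = inj₁ λ { (s≤s _) (s≤s ()) }
  Simple-or-closed f (suc k) with Simple-or-closed f k
  ... | inj₂ (l , l<k , rest) = inj₂ (l , m≤n⇒m≤1+n l<k , rest)
  ... | inj₁ simple with ⟦ f , suc k ⟧? (iter σ (suc k) f)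
  ...   | no ∉ = inj₁ λ i<j j<2+k → distinct i<j (m≤n⇒m<n∨m≡n (s≤s⁻¹ j<2+k))
    where
    distinct : ∀ {i j} → i < j → j < suc k ⊎ j ≡ suc k → iter σ i f ≢ iter σ j f
    distinct i<j (inj₁ j<k)  p = simple i<j j<k p
    distinct i<k (inj₂ refl) p = ∉ (_ , i<k , p)
  ...   | yes ∈ = inj₂ (k , ≤-refl , simple , closed)
    where
    closed : ∀ {e} → ⟦ f , suc k ⟧ e → ⟦ f , suc k ⟧ (σ e)
    closed (i , i<k , refl) with m≤n⇒m<n∨m≡n i<k
    ... | inj₁ 1+i<k = suc i , 1+i<k , refl
    ... | inj₂ refl  = ∈

  -- Cutting at the first repetition loses nothing, since a `σ`-closed arc from `f` contains every
  -- iterate of `f`.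
  simplify : ∀ f k → ∃ λ l → Simple (f , suc l) × (∀ e → ⟦ f , suc k ⟧ e ⇔ ⟦ f , suc l ⟧ e)
  simplify f k with Simple-or-closed f k
  ... | inj₁ simple = k , simple , λ e → ⇔-refl
  ... | inj₂ (l , l<k , simple , closed) = l , simple , λ e → mk⇔
      (λ (i , _ , p) → subst ⟦ f , suc l ⟧ p (all i))
      (λ (i , i<l , p) → i , <-trans i<l (s≤s l<k) , p)
    where
    all : ∀ i → ⟦ f , suc l ⟧ (iter σ i f)
    all zero    = 0 , z<s , refl
    all (suc i) = closed (all i)

  Meets : Arc → Arc → Set
  Meets a b = ⟦ a ⟧ (first b) ⊎ ⟦ a ⟧ (last b)

  -- Condition (*), the invariant of the reduction.
  Good : (Fin m → Arc) → Set
  Good a = ∀ {i j} → i ≢ j → 0 < len (a i) → ⟦ a i ⟧ ⊆ ⟦ a j ⟧ → Meets (a i) (a j)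

  -- As a set, `b` is `a` without `r`; that `r` is an end of `a` is supplied by `drop-last` and
  -- `drop-first`.
  WithoutEnd : Arc → Arc → E → Set
  WithoutEnd a b r =
    len b < len a × Simple b × (∀ {e} → ⟦ b ⟧ e → ⟦ a ⟧ e) × ¬ ⟦ b ⟧ r
    × (∀ {e} → ⟦ a ⟧ e → e ≢ r → ⟦ b ⟧ e)

  -- The last two components carry (*) through the removal. A `c` inside `b` misses the removed end,
  -- so it contains the other one, which is still an end of `b`. A `c` around `b` that misses the
  -- removed end must stop just before it, at `last b`.
  drop-last : ∀ a → Simple a → 0 < len a →
              ∃ λ b → WithoutEnd a b (last a)
                × (∀ c → 0 < len c → ⟦ c ⟧ ⊆ ⟦ b ⟧ → Meets c a → Meets c b)
                × (∀ c → 0 < len b → ⟦ b ⟧ ⊆ ⟦ c ⟧ → ¬ ⟦ c ⟧ (last a) → Meets b c)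
  drop-last (f , suc n) simple _ =
    (f , n) , (≤-refl , (λ i<j j<n → simple i<j (m≤n⇒m≤1+n j<n)) ,
               (λ (i , i<n , p) → i , m≤n⇒m≤1+n i<n , p) , r∉ , kept) ,
    (λ c _ c⊆b → λ where
      (inj₁ f∈c) → inj₁ f∈c
      (inj₂ r∈c) → contradiction (c⊆b _ r∈c) r∉) ,
    leave
    where
    r∉ : ¬ ⟦ f , n ⟧ (iter σ n f)
    r∉ (i , i<n , p) = simple i<n ≤-refl p
    kept : ∀ {e} → ⟦ f , suc n ⟧ e → e ≢ iter σ n f → ⟦ f , n ⟧ e
    kept (i , i<1+n , p) e≢r with m≤n⇒m<n∨m≡n (s≤s⁻¹ i<1+n)
    ... | inj₁ i<n  = i , i<n , p
    ... | inj₂ refl = contradiction (sym p) e≢r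
    leave : ∀ c → 0 < n → ⟦ f , n ⟧ ⊆ ⟦ c ⟧ → ¬ ⟦ c ⟧ (iter σ n f) → Meets (f , n) c
    leave c (s≤s _) b⊆c r∉c =
      inj₂ (subst ⟦ f , n ⟧ (leave-last c (b⊆c _ b∋) r∉c) b∋)
      where b∋ = last∈ (f , n) z<s

  drop-first : ∀ a → Simple a → 0 < len a →
               ∃ λ b → WithoutEnd a b (first a)
                 × (∀ c → 0 < len c → ⟦ c ⟧ ⊆ ⟦ b ⟧ → Meets c a → Meets c b)
                 × (∀ c → 0 < len b → ⟦ b ⟧ ⊆ ⟦ c ⟧ → ¬ ⟦ c ⟧ (first a) → Meets b c)
  drop-first (f , suc n) simple _ =
    (σ f , n) , (≤-refl , (λ {i} {j} → Simple-tail f n simple {i} {j}) ,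
                 (λ (i , i<n , p) → suc i , s≤s i<n , trans (iter-suc σ i f) p) , r∉ , kept) ,
    shrunk , enter
    where
    r∉ : ¬ ⟦ σ f , n ⟧ f
    r∉ (i , i<n , p) = simple z<s (s≤s i<n) (sym (trans (iter-suc σ i f) p))
    kept : ∀ {e} → ⟦ f , suc n ⟧ e → e ≢ f → ⟦ σ f , n ⟧ e
    kept (zero  , _     , p) e≢f = contradiction (sym p) e≢f
    kept (suc i , i<n   , p) _   = i , s≤s⁻¹ i<n , trans (sym (iter-suc σ i f)) p
    shrunk : ∀ c → 0 < len c → ⟦ c ⟧ ⊆ ⟦ σ f , n ⟧ → Meets c (f , suc n) → Meets c (σ f , n)
    shrunk c 0<c c⊆b (inj₁ f∈c) = contradiction (c⊆b _ f∈c) r∉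
    -- `iter σ n f` is `last (σ f , n)` once `n` is positive, and `b` is nonempty because it
    -- contains this element of `c`.
    shrunk c 0<c c⊆b (inj₂ l∈c) =
      inj₂ (subst ⟦ c ⟧ (last-shift n (occupied (σ f , n) (c⊆b _ l∈c))) l∈c)
      where
      last-shift : ∀ k → 0 < k → iter σ k f ≡ last (σ f , k)
      last-shift (suc k) _ = iter-suc σ k f
    enter : ∀ c → 0 < n → ⟦ σ f , n ⟧ ⊆ ⟦ c ⟧ → ¬ ⟦ c ⟧ f → Meets (σ f , n) c
    enter c 0<n b⊆c f∉c =
      inj₁ (subst ⟦ σ f , n ⟧ (enter-first c f∉c (b⊆c _ b∋)) b∋)
      where b∋ = first∈ (σ f , n) 0<n

  -- The two ends of c are distinct, so at most one of them is r.
  equal-meets : ∀ {a b r} c → Simple c → 2 ≤ len c → ⟦ c ⟧ ⊆ ⟦ a ⟧ → WithoutEnd a b r → Meets b c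
  equal-meets {a} {b} {r} c@(f , suc (suc n)) simple (s≤s (s≤s _)) c⊆a (_ , _ , _ , _ , kept) with f ≟ r
  ... | no f≢r   = inj₁ (kept (c⊆a _ (first∈ c z<s)) f≢r)
  ... | yes refl = inj₂ (kept (c⊆a _ (last∈ c z<s)) (simple z<s ≤-refl ∘ sym))

  -- One reduction step, uniform in which end `r` of `a j` is dropped; `below` and `above` are the
  -- two transfer properties that come with the shortened arc `b`.
  module Shrink {m} (a : Fin m → Arc) (simple : ∀ j → Simple (a j)) (good : Good a)
                {i j : Fin m} (i≢j : i ≢ j) (0<i : 0 < len (a i)) (i⊆j : ⟦ a i ⟧ ⊆ ⟦ a j ⟧)
                (max : ∀ k → 0 < len (a j) → j ≢ k → ⟦ a j ⟧ ⊆ ⟦ a k ⟧ → len (a k) ≤ len (a j))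
                {b : Arc} {r : E} (without : WithoutEnd (a j) b r)
                (below : ∀ c → 0 < len c → ⟦ c ⟧ ⊆ ⟦ b ⟧ → Meets c (a j) → Meets c b)
                (above : ∀ c → 0 < len b → ⟦ b ⟧ ⊆ ⟦ c ⟧ → ¬ ⟦ c ⟧ r → Meets b c)
                (r∈i : ⟦ a i ⟧ r) where

    b<j = proj₁ without
    b⊆j = proj₁ (proj₂ (proj₂ without))
    r∉b = proj₁ (proj₂ (proj₂ (proj₂ without)))
    kept = proj₂ (proj₂ (proj₂ (proj₂ without)))

    a′ : Fin m → Arc
    a′ = updateAt a j (const b)

    a′-cases : ∀ k → (k ≡ j × a′ k ≡ b) ⊎ (k ≢ j × a′ k ≡ a k)
    a′-cases k with k ≟ᶠ j
    ... | yes refl = inj₁ (refl , updateAt-updates j a)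
    ... | no k≢j   = inj₂ (k≢j , updateAt-minimal k j a k≢j)

    simple′ : ∀ k → Simple (a′ k)
    simple′ k with a′-cases k
    ... | inj₁ (refl , eq) rewrite eq = proj₁ (proj₂ without)
    ... | inj₂ (_ , eq) rewrite eq = simple k

    meets-above : ∀ k → j ≢ k → 0 < len b → ⟦ b ⟧ ⊆ ⟦ a k ⟧ → Meets b (a k)
    meets-above k j≢k 0<b b⊆k with ⟦ a k ⟧? r
    ... | no r∉k  = above (a k) 0<b b⊆k r∉k
    -- Here `a k` contains all of `a j`, so by maximality they agree as sets. As `b` is nonempty and
    -- shorter than `a j`, there are at least two elements.
    ... | yes r∈k = equal-meets (a k) (simple k)
                      (≤-trans (≤-trans (s≤s 0<b) b<j) j≤k)
                      (⊆-antisym-≤ (a j) (a k) (simple j) j⊆k (max k (≤-trans z<s b<j) j≢k j⊆k))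
                      without
      where
      j⊆k : ⟦ a j ⟧ ⊆ ⟦ a k ⟧
      j⊆k e e∈j with e ≟ r
      ... | yes refl = r∈k
      ... | no e≢r   = b⊆k e (kept e∈j e≢r)
      j≤k : len (a j) ≤ len (a k)
      j≤k = size-≤ (a k) (λ n → iter σ (toℕ n) (first (a j)))
              (λ {n} {n′} p → toℕ-injective (Simple-injective (a j) (simple j) (toℕ<n n) (toℕ<n n′) p))
              (λ n → j⊆k _ (toℕ n , toℕ<n n , refl))

    -- Only pairs involving `j` change. With `b` as the smaller member `meets-above` applies; with
    -- `b` as the larger one, `a k` already lay in `a j` and `below` transfers the old end.
    good′ : Good a′
    good′ {k} {l} k≢l 0<k k⊆l with a′-cases k | a′-cases l
    ... | inj₁ (refl , _)  | inj₁ (refl , _)  = contradiction refl k≢l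
    ... | inj₁ (refl , eq) | inj₂ (_ , eq′) rewrite eq | eq′ = meets-above l k≢l 0<k k⊆l
    ... | inj₂ (_ , eq) | inj₁ (refl , eq′) rewrite eq | eq′ =
          below (a k) 0<k k⊆l (good k≢l 0<k λ e e∈k → b⊆j (k⊆l e e∈k))
    ... | inj₂ (_ , eq) | inj₂ (_ , eq′) rewrite eq | eq′ = good k≢l 0<k k⊆l

    smaller : sum (len ∘ a′) < sum (len ∘ a)
    smaller = sum-mono-< ≤a j <a
      where
      ≤a : ∀ k → len (a′ k) ≤ len (a k)
      ≤a k with a′-cases k
      ... | inj₁ (refl , eq) rewrite eq = <⇒≤ b<j
      ... | inj₂ (_ , eq) rewrite eq = ≤-refl
      <a : len (a′ j) < len (a j)
      <a rewrite updateAt-updates j {const b} a = b<j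

    match′ : ∀ X → Match (⟦_⟧ ∘ a) X ⇔ Match (⟦_⟧ ∘ a′) X
    match′ = Match-shrink _≟_ i≢j i⊆j r∈i a′⊆a a∖⊆a′
      where
      a′⊆a : ∀ k → ⟦ a′ k ⟧ ⊆ ⟦ a k ⟧
      a′⊆a k e p with a′-cases k
      ... | inj₁ (refl , eq) rewrite eq = b⊆j p
      ... | inj₂ (_ , eq) rewrite eq = p
      a∖⊆a′ : ∀ k e → ⟦ a k ⟧ e → k ≢ j ⊎ e ≢ r → ⟦ a′ k ⟧ e
      a∖⊆a′ k e p q with a′-cases k
      ... | inj₂ (_ , eq) rewrite eq = p
      a∖⊆a′ k e p (inj₁ k≢j) | inj₁ (refl , eq) = contradiction refl k≢j
      a∖⊆a′ k e p (inj₂ e≢r) | inj₁ (refl , eq) rewrite eq = kept p e≢r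

  Contains : (Fin m → Arc) → Fin m → Set
  Contains a j = ∃ λ i → i ≢ j × 0 < len (a i) × ⟦ a i ⟧ ⊆ ⟦ a j ⟧

  Contains? : (a : Fin m → Arc) → ∀ j → Dec (Contains a j)
  Contains? a j = any? λ i → ¬? (i ≟ᶠ j) ×-dec (0 <? len (a i)) ×-dec (a i ⊆? a j)

  -- The fuel `n` bounds the total length, which each step lowers. Condition (*) tells which end of
  -- the chosen arc lies in the smaller member and may be dropped. Empty members are left for
  -- `prune`.
  reduce : ∀ n (a : Fin m → Arc) → sum (len ∘ a) < n → (∀ j → Simple (a j)) → Good a →
           ∃ λ (b : Fin m → Arc) →
             (∀ i j → i ≢ j → 0 < len (b i) → ¬ ⟦ b i ⟧ ⊆ ⟦ b j ⟧)
             × (∀ X → Match (⟦_⟧ ∘ a) X ⇔ Match (⟦_⟧ ∘ b) X)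
  reduce {m} (suc n) a a<n simple good with any? (Contains? a)
  ... | no none = a , (λ i j i≢j 0<i i⊆j → none (_ , _ , i≢j , 0<i , i⊆j)) , λ X → ⇔-refl
  ... | yes some with argmax (Contains? a) (len ∘ a) some
  ...   | j , (i , i≢j , 0<i , i⊆j) , max = step (good i≢j 0<i i⊆j)
    where
    0<j : 0 < len (a j)
    0<j = occupied (a j) (i⊆j _ (first∈ (a i) 0<i))
    -- A member around `a j` contains another member, so it was itself a candidate in the maximum.
    maximal : ∀ k → 0 < len (a j) → j ≢ k → ⟦ a j ⟧ ⊆ ⟦ a k ⟧ → len (a k) ≤ len (a j)
    maximal k 0<j j≢k j⊆k = max k (j , j≢k , 0<j , j⊆k)
    step : Meets (a i) (a j) → _
    step (inj₁ f∈i) =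
      let (b , without , below , above) = drop-first (a j) (simple j) 0<j
          open Shrink a simple good i≢j 0<i i⊆j maximal {b} without below above f∈i
          (c , anti , match) = reduce n a′ (<-≤-trans smaller (s≤s⁻¹ a<n)) simple′ good′
      in c , anti , λ X → ⇔-trans (match′ X) (match X)
    step (inj₂ l∈i) =
      let (b , without , below , above) = drop-last (a j) (simple j) 0<j
          open Shrink a simple good i≢j 0<i i⊆j maximal {b} without below above l∈i
          (c , anti , match) = reduce n a′ (<-≤-trans smaller (s≤s⁻¹ a<n)) simple′ good′
      in c , anti , λ X → ⇔-trans (match′ X) (match X)

  -- Injectivity of `φ` lets incomparability of distinct members pass to the subfamily.
  prune : ∀ m (a : Fin m → Arc) →
          ∃ λ m′ → Σ (Fin m′ → Fin m) λ φ →
            Injective _≡_ _≡_ φ × (∀ i → 0 < len (a (φ i)))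
            × (∀ X → Match (⟦_⟧ ∘ a) X ⇔ Match (⟦_⟧ ∘ a ∘ φ) X)
  prune zero a = 0 , id , id , (λ ()) , λ X → ⇔-refl
  prune (suc m) a with any? (λ j → ¬? (0 <? len (a j)))
  ... | no none = suc m , id , id ,
        (λ i → decidable-stable (0 <? _) λ ≮ → none (i , ≮)) , λ X → ⇔-refl
  ... | yes (j , ≮) with prune m (a ∘ punchIn j)
  ...   | m′ , φ , φ-inj , 0< , match =
        m′ , punchIn j ∘ φ , (λ p → φ-inj (punchIn-injective j _ _ p)) , 0< ,
        λ X → ⇔-trans (Match-removeAt (⟦_⟧ ∘ a) j (λ e e∈j → ≮ (occupied (a j) e∈j)) X) (match X)

-- Positions with one index left out.

-- The ℕ-indexed version of punchIn.
skip : ℕ → ℕ → ℕ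
skip zero    t       = suc t
skip (suc i) zero    = zero
skip (suc i) (suc t) = suc (skip i t)

skip-mono-< : ∀ i {s t} → s < t → skip i s < skip i t
skip-mono-< zero    s<t               = s≤s s<t
skip-mono-< (suc i) {zero}  {suc t} _   = z<s
skip-mono-< (suc i) {suc s} {suc t} s<t = s≤s (skip-mono-< i (s≤s⁻¹ s<t))

skip-< : ∀ i {t n} → t < n → skip i t < suc n
skip-< zero    t<n                     = s≤s t<n
skip-< (suc i) {zero}  {suc n} t<n       = z<s
skip-< (suc i) {suc t} {suc n} (s≤s t<n) = s≤s (skip-< i t<n)

skip-surjective : ∀ i {s n} → i < suc n → s < suc n → s ≢ i → ∃ λ t → t < n × skip i t ≡ s
skip-surjective zero    {zero}          _   _   s≢i = contradiction refl s≢i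
skip-surjective zero    {suc s}         _   s<n _   = s , s≤s⁻¹ s<n , refl
skip-surjective (suc i) {zero}  {suc n} _   _   _   = 0 , z<s , refl
skip-surjective (suc i) {suc s} {suc n} i<n s<n s≢i =
  let (t , t<n , p) = skip-surjective i (s≤s⁻¹ i<n) (s≤s⁻¹ s<n) (s≢i ∘ cong suc)
  in suc t , s≤s t<n , cong suc p
skip-surjective (suc i) {_} {zero} (s≤s ())

-- Deleting a point from matchings, from the cyclic order and from arcs.

module Deletion {E : Set} (_≟_ : DecidableEquality E) (x : E) where

  E′ : Set
  E′ = Minus E _≟_ x

  Minus-≡ : {y z : E′} → proj₁ y ≡ proj₁ z → y ≡ z
  Minus-≡ {y , p} {_ , q} refl = cong (y ,_) (T-irrelevant p q)

  infix 4 _≟′_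
  _≟′_ : DecidableEquality E′
  y ≟′ z = map′ Minus-≡ (cong proj₁) (proj₁ y ≟ proj₁ z)

  avoids : (y : E′) → proj₁ y ≢ x
  avoids (_ , p) = toWitnessFalse p

  extend : SubsetOf E′ → SubsetOf E
  extend X e = Σ (False (e ≟ x)) λ p → X (e , p)

  Match-delete : (A : Fin m → SubsetOf E) (X : SubsetOf E′) →
                 Match A (extend X) ⇔ Match (λ j y → A j (proj₁ y)) X
  Match-delete {m} A X = mk⇔ ⇒ ⇐
    where
    ⇒ : Match A (extend X) → Match (λ j y → A j (proj₁ y)) X
    ⇒ (g , inj , mem , cov) =
      strip ∘ g , (λ p q → inj (strip⁻ p) (strip⁻ q)) , (λ p → mem (strip⁻ p)) , λ y → mk⇔
        (λ Xy → let (k , p) = to (cov (proj₁ y)) (proj₂ y , Xy) in k , strip⁺ y p)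
        (λ (k , p) → let (_ , Xy) = from (cov (proj₁ y)) (k , strip⁻ p) in subst X (Minus-≡ refl) Xy)
      where
      strip : Maybe E → Maybe E′
      strip nothing  = nothing
      strip (just e) with e ≟ x
      -- Not reached for any value of `g`: a matched `x` would lie in `extend X`.
      ... | yes _  = nothing
      ... | no e≢x = just (e , fromWitnessFalse e≢x)
      strip⁻ : ∀ {z y} → strip z ≡ just y → z ≡ just (proj₁ y)
      strip⁻ {just e} p with e ≟ x
      strip⁻ {just e} refl | no _ = refl
      strip⁺ : ∀ {z} y → z ≡ just (proj₁ y) → strip z ≡ just y
      strip⁺ y refl with proj₁ y ≟ x
      ... | yes y≡x = contradiction y≡x (avoids y)
      ... | no _    = cong just (Minus-≡ refl)
    ⇐ : Match (λ j y → A j (proj₁ y)) X → Match A (extend X)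
    ⇐ (g , inj , mem , cov) = Maybe.map proj₁ ∘ g , inj′ , mem′ , λ e → mk⇔
        (λ (p , Xe) → let (k , q) = to (cov (e , p)) Xe in k , cong (Maybe.map proj₁) q)
        (λ (k , q) → let (y , r , s) = drop (g k) q in back s (from (cov y) (k , r)))
      where
      drop : ∀ z {e} → Maybe.map proj₁ z ≡ just e → ∃ λ (y : E′) → z ≡ just y × proj₁ y ≡ e
      drop (just y) refl = y , refl , refl
      back : ∀ {y e} → proj₁ y ≡ e → X y → extend X e
      back {y} refl Xy = proj₂ y , Xy
      inj′ : ∀ {k l e} → Maybe.map proj₁ (g k) ≡ just e → Maybe.map proj₁ (g l) ≡ just e → k ≡ l
      inj′ {k} {l} p q with drop (g k) p | drop (g l) q
      ... | y , r , refl | z , s , t with refl ← Minus-≡ {z} {y} t = inj r s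
      mem′ : ∀ {k e} → Maybe.map proj₁ (g k) ≡ just e → A k e
      mem′ {k} p with drop (g k) p
      ... | y , r , refl = mem r

  -- `g′` is the first-return map of `g` to `E′`; as `g x ≢ x`, one extra step always suffices.
  module Skip (g : E → E) (gx≢x : g x ≢ x) where

    lift : E → E′
    lift e with e ≟ x
    ... | yes _  = g x , fromWitnessFalse gx≢x
    ... | no e≢x = e , fromWitnessFalse e≢x

    lift-≢ : ∀ {e} → e ≢ x → proj₁ (lift e) ≡ e
    lift-≢ {e} e≢x with e ≟ x
    ... | yes e≡x = contradiction e≡x e≢x
    ... | no _    = refl

    lift-x : proj₁ (lift x) ≡ g x
    lift-x with x ≟ x
    ... | yes _  = refl
    ... | no x≢x = contradiction refl x≢x

    g′ : E′ → E′
    g′ y = lift (g (proj₁ y))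

    -- The `g′`-orbit is the `g`-orbit with the visits to `x` left out; this makes `g′` cyclic when
    -- `g` is.
    reach : ∀ k y → iter g k (proj₁ y) ≢ x → ∃ λ l → proj₁ (iter g′ l y) ≡ iter g k (proj₁ y)
    reach zero    y _ = 0 , refl
    reach (suc k) y ≢x with iter g k (proj₁ y) ≟ x
    ... | no ≢x′ = let (l , p) = reach k y ≢x′ in
                   suc l , trans (cong (proj₁ ∘ lift ∘ g) p) (lift-≢ ≢x)
    reach (suc zero)    y ≢x | yes y≡x = contradiction y≡x (avoids y)
    -- The orbit is at `x` after `suc k` steps, hence not after `k`; the two `g`-steps around `x`
    -- make one `g′`-step.
    reach (suc (suc k)) y ≢x | yes ≡x  =
      let (l , p) = reach k y λ ≡x′ → gx≢x (trans (cong g (sym ≡x′)) ≡x) in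
      suc l , trans (cong (proj₁ ∘ lift) (trans (cong g p) ≡x)) (trans lift-x (cong g (sym ≡x)))

  -- If `h y` is `x`, the map induced by `h` sends `y` to `h x`; then `g` leads to `x`, and the lift
  -- moves on to `g x`, which is `y`.
  skip-inverse : ∀ {g h} (gx≢x : g x ≢ x) (hx≢x : h x ≢ x) → (∀ e → g (h e) ≡ e) →
                 ∀ y → Skip.g′ g gx≢x (Skip.g′ h hx≢x y) ≡ y
  skip-inverse {g} {h} gx≢x hx≢x gh y with h (proj₁ y) ≟ x
  ... | no _  = Minus-≡ (trans (cong (proj₁ ∘ lift) (gh (proj₁ y))) (lift-≢ (avoids y)))
    where open Skip g gx≢x
  ... | yes p = Minus-≡ (trans (cong (proj₁ ∘ lift) (gh x)) (trans lift-x (trans (cong g (sym p)) (gh (proj₁ y)))))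
    where open Skip g gx≢x

  module DeleteArcs (g : E → E) (g-inj : Injective _≡_ _≡_ g) (gx≢x : g x ≢ x)
                    (g′-inj : Injective _≡_ _≡_ (Skip.g′ g gx≢x)) where

    open Skip g gx≢x
    open Arcs _≟_ g g-inj
    module A′ = Arcs _≟′_ g′ g′-inj

    iter-lift : ∀ f t → (∀ s → s < t → iter g s f ≢ x) → iter g′ t (lift f) ≡ lift (iter g t f)
    iter-lift f zero    _  = refl
    iter-lift f (suc t) ≢x =
      trans (cong g′ (iter-lift f t λ s s<t → ≢x s (m≤n⇒m≤1+n s<t)))
            (cong (lift ∘ g) (lift-≢ (≢x t ≤-refl)))

    -- Since the arc is simple, `x` occurs only at position `i`, so exactly the positions from `i`
    -- on are shifted by one.
    iter-lift-skip : ∀ f i k t → Simple (f , suc k) → iter g i f ≡ x → i < suc k → t < k →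
                     proj₁ (iter g′ t (lift f)) ≡ iter g (skip i t) f
    iter-lift-skip f zero k t simple refl _ t<k =
      -- With `x` in front, `lift f` already is the next element `g x`.
      trans (cong (proj₁ ∘ iter g′ t) (Minus-≡ (trans lift-x (sym (lift-≢ gx≢x)))))
      (trans (cong proj₁ (iter-lift (g f) t λ s s<t → away s (<-trans s<t t<k)))
      (trans (lift-≢ (away t t<k)) (sym (iter-suc g t f))))
      where
      away : ∀ s → s < k → iter g s (g f) ≢ f
      away s s<k p = simple z<s (s≤s s<k) (sym (trans (iter-suc g s f) p))
    iter-lift-skip f (suc i) k zero simple p i<k _ =
      lift-≢ λ f≡x → simple z<s i<k (trans f≡x (sym p))
    iter-lift-skip f (suc i) (suc k) (suc t) simple p i<k (s≤s t<k) =
      trans (cong proj₁ (iter-suc g′ t (lift f)))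
      (trans (cong (λ e → proj₁ (iter g′ t (lift (g e)))) (lift-≢ λ f≡x → simple z<s i<k (trans f≡x (sym p))))
      (trans (iter-lift-skip (g f) i k t (λ {i} {j} → Simple-tail f (suc k) simple {i} {j})
                (trans (sym (iter-suc g i f)) p) (s≤s⁻¹ i<k) t<k)
             (sym (iter-suc g (skip i t) f))))

    Deletes : Arc → A′.Arc → Set
    Deletes a b = A′.Simple b × (∀ y → A′.⟦ b ⟧ y ⇔ ⟦ a ⟧ (proj₁ y))

    -- `d` lists the surviving positions in order; it is `skip i` or `id` according to whether the
    -- arc passes through `x`.
    thin : ∀ {f k f′ k′} (d : ℕ → ℕ) → Simple (f , k) →
           (∀ {s t} → s < t → d s < d t) → (∀ {t} → t < k′ → d t < k) →
           (∀ t → t < k′ → proj₁ (iter g′ t f′) ≡ iter g (d t) f) →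
           (∀ i → i < k → iter g i f ≢ x → ∃ λ t → t < k′ × d t ≡ i) →
           Deletes (f , k) (f′ , k′)
    thin {f} d simple d-mono d<k d-eq d-surj =
      (λ s<t t<k′ p → simple (d-mono s<t) (d<k t<k′)
         (trans (sym (d-eq _ (<-trans s<t t<k′))) (trans (cong proj₁ p) (d-eq _ t<k′)))) ,
      λ y → mk⇔
        (λ (t , t<k′ , p) → d t , d<k t<k′ , trans (sym (d-eq t t<k′)) (cong proj₁ p))
        (λ (i , i<k , p) → let (t , t<k′ , q) = d-surj i i<k (λ ≡x → avoids y (trans (sym p) ≡x)) in
           t , t<k′ , Minus-≡ (trans (d-eq t t<k′) (trans (cong (λ n → iter g n f) q) p)))

    -- Ends are recorded for arcs that miss `x`, because an arc that comes to contain another one is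
    -- of this kind.
    delete : ∀ f k → Simple (f , suc k) → ∃ λ b → Deletes (f , suc k) b ×
             (¬ ⟦ f , suc k ⟧ x → proj₁ (A′.first b) ≡ f × proj₁ (A′.last b) ≡ iter g k f)
    delete f k simple with ⟦ f , suc k ⟧? x
    ... | yes (i , i<k , p) = (lift f , k) ,
          thin (skip i) simple (skip-mono-< i) (skip-< i)
            (λ t t<k → iter-lift-skip f i k t simple p i<k t<k)
            (λ s s<k ≢x → skip-surjective i i<k s<k λ { refl → ≢x p }) ,
          λ ∉ → contradiction (i , i<k , p) ∉
    ... | no ∉ = (lift f , suc k) ,
          thin id simple id id iter-id (λ i i<k _ → i , i<k , refl) ,
          λ _ → iter-id 0 z<s , iter-id k ≤-refl
      where
      iter-id : ∀ t → t < suc k → proj₁ (iter g′ t (lift f)) ≡ iter g t f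
      iter-id t t<k = trans (cong proj₁ (iter-lift f t λ s s<t p → ∉ (s , <-trans s<t t<k , p)))
                            (lift-≢ λ p → ∉ (t , t<k , p))

    -- A new inclusion forces `x` into `a` and out of `c`. A neighbour of `x` in `a` lies in `c`
    -- next to a point outside `c`, hence is an end of `c`. Without a neighbour, `a` is just `x` and
    -- `b` would be empty.
    delete-meets : ∀ {a b c d} → Deletes a b → Deletes c d →
                   (¬ ⟦ c ⟧ x → proj₁ (A′.first d) ≡ first c × proj₁ (A′.last d) ≡ last c) →
                   ¬ ⟦ a ⟧ ⊆ ⟦ c ⟧ → 0 < A′.len b → A′.⟦ b ⟧ ⊆ A′.⟦ d ⟧ → A′.Meets b d
    delete-meets {a} {b} {c} {d} (_ , a⇔b) (_ , c⇔d) ends a⊈c 0<b b⊆d = meets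
      where
      carry : ∀ {e} → ⟦ a ⟧ e → e ≢ x → ⟦ c ⟧ e
      carry {e} e∈a e≢x =
        to (c⇔d y) (b⊆d y (from (a⇔b y) e∈a))
        where y = e , fromWitnessFalse e≢x
      x∈a : ⟦ a ⟧ x
      x∈a = decidable-stable (⟦ a ⟧? x) λ x∉a → a⊈c λ e e∈a → carry e∈a λ { refl → x∉a e∈a }
      x∉c : ¬ ⟦ c ⟧ x
      x∉c x∈c = a⊈c a⊆c
        where
        a⊆c : ⟦ a ⟧ ⊆ ⟦ c ⟧
        a⊆c e e∈a with e ≟ x
        ... | yes refl = x∈c
        ... | no e≢x   = carry e∈a e≢x
      meets : A′.Meets b d
      meets with neighbours a x∈a
      ... | inj₁ gx∈a = inj₁ (from (a⇔b _) (subst ⟦ a ⟧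
              (trans (enter-first c x∉c (carry gx∈a gx≢x)) (sym (proj₁ (ends x∉c)))) gx∈a))
      ... | inj₂ (inj₁ (w , refl , w∈a)) = inj₂ (from (a⇔b _) (subst ⟦ a ⟧
              (trans (leave-last c (carry w∈a (λ w≡x → gx≢x (cong g (sym w≡x)))) x∉c)
                     (sym (proj₂ (ends x∉c)))) w∈a))
      ... | inj₂ (inj₂ only) =
            contradiction (only _ (to (a⇔b _) (A′.first∈ b 0<b))) (avoids (A′.first b))

-- From arcs back to intervals, and the assembly of the presentation.

⟦⟧⇔interval : (σ : CyclicPerm E) (f e : E) (k : ℕ) →
  (∃ λ i → i < suc k × iter (Inverse.to (CyclicPerm.perm σ)) i f ≡ e) ⇔
  (Σ ℕ λ i → i ≤ k × iter (Inverse.to (CyclicPerm.perm σ)) i f ≡ e)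
⟦⟧⇔interval σ f e k = mk⇔ (λ (i , i<k , p) → i , s≤s⁻¹ i<k , p) (λ (i , i≤k , p) → i , s≤s i≤k , p)

Match-cong : {A B : Fin m → SubsetOf E} → (∀ k e → A k e ⇔ B k e) → ∀ X → Match A X ⇔ Match B X
Match-cong A⇔B X = mk⇔ (Match-mono λ k e → to (A⇔B k e)) (Match-mono λ k e → from (A⇔B k e))

iter-fixed : (f : E → E) {x : E} → f x ≡ x → ∀ k → iter f k x ≡ x
iter-fixed f p zero    = refl
iter-fixed f p (suc k) = trans (cong f (iter-fixed f p k)) p

left-inverse⇒injective : (h k : E → E) → (∀ e → k (h e) ≡ e) → Injective _≡_ _≡_ h
left-inverse⇒injective h k kh p = trans (sym (kh _)) (trans (cong k p) (kh _))

module _ (E : Set) (_≟_ : DecidableEquality E) (Ind : SubsetOf E → Set) (x : E)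
         (σ : CyclicPerm E) {m : ℕ} (A : Fin m → SubsetOf E)
         (intervals : ∀ j → IsInterval σ (A j)) (antichain : IsAntichain A)
         (ind : ∀ X → Ind X ⇔ TransInd A X) where

  open CyclicPerm σ
  open Deletion _≟_ x

  g g⁻¹ : E → E
  g   = Inverse.to perm
  g⁻¹ = Inverse.from perm

  g∘g⁻¹ : ∀ e → g (g⁻¹ e) ≡ e
  g∘g⁻¹ = Inverse.strictlyInverseˡ perm

  g⁻¹∘g : ∀ e → g⁻¹ (g e) ≡ e
  g⁻¹∘g = Inverse.strictlyInverseʳ perm

  delete-Match : ∀ X → Delete E _≟_ Ind x X ⇔ Match (λ j y → A j (proj₁ y)) X
  delete-Match X = ⇔-trans (ind (extend X))
                  (⇔-trans (TransInd⇔Match A (extend X)) (Match-delete A X))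

  -- A fixed point of a cyclic permutation is the whole ground set, so `E′` is empty and the empty
  -- family presents the deletion.
  delete-fixed : g x ≡ x → IsMultiPath E′ (Delete E _≟_ Ind x)
  delete-fixed gx≡x =
    record { perm = ↔-id E′ ; cyclic = λ y → ⊥-elim (absurd y) } ,
    0 , none , (λ ()) , (λ ()) , λ X → mk⇔
      (λ _ → from (TransInd⇔Match none X) (empty X))
      (λ _ → from (delete-Match X) (empty X))
    where
    none : Fin 0 → SubsetOf E′
    none ()
    absurd : ¬ E′
    absurd y = avoids y (let (k , p) = cyclic x (proj₁ y) in trans (sym p) (iter-fixed g gx≡x k))
    empty : ∀ {n} {B : Fin n → SubsetOf E′} X → Match B X
    empty X = const nothing , (λ ()) , (λ ()) , λ y → ⊥-elim (absurd y)

  delete-moved : g x ≢ x → IsMultiPath E′ (Delete E _≟_ Ind x)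
  delete-moved gx≢x =
    σ′ , m′ , A′.⟦_⟧ ∘ c ∘ φ , interval , antichain′ , λ X →
      -- The presentation passes from `A` on `E′` to the arcs `b`, to the reduced family `c`, and to
      -- its nonempty members.
      ⇔-trans (delete-Match X)
      (⇔-trans (Match-cong A⇔b X)
      (⇔-trans (match X)
      (⇔-trans (match′ X) (⇔-sym (TransInd⇔Match _ X)))))
    where
    g⁻¹x≢x : g⁻¹ x ≢ x
    g⁻¹x≢x p = gx≢x (trans (cong g (sym p)) (g∘g⁻¹ x))
    open Skip g gx≢x
    h′ : E′ → E′
    h′ = Skip.g′ g⁻¹ g⁻¹x≢x
    g′∘h′ : ∀ y → g′ (h′ y) ≡ y
    g′∘h′ = skip-inverse gx≢x g⁻¹x≢x g∘g⁻¹
    h′∘g′ : ∀ y → h′ (g′ y) ≡ y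
    h′∘g′ = skip-inverse g⁻¹x≢x gx≢x g⁻¹∘g
    open DeleteArcs g (left-inverse⇒injective g g⁻¹ g⁻¹∘g) gx≢x (left-inverse⇒injective g′ h′ h′∘g′)
    open Arcs _≟_ g (left-inverse⇒injective g g⁻¹ g⁻¹∘g)

    σ′ : CyclicPerm E′
    σ′ = record
      { perm   = mk↔ₛ′ g′ h′ g′∘h′ h′∘g′
      ; cyclic = λ y z → let (k , p) = cyclic (proj₁ y) (proj₁ z)
                             (l , q) = reach k y (λ ≡x → avoids z (trans (sym p) ≡x))
                         in l , Minus-≡ (trans q p) }

    arc : ∀ j → ∃ λ f → ∃ λ k → Simple (f , suc k) × (∀ e → A j e ⇔ ⟦ f , suc k ⟧ e)
    arc j =
      let (f , k , A⇔) = intervals j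
          (l , simple , ⇔l) = simplify f k
      in f , l , simple , λ e → ⇔-trans (A⇔ e) (⇔-trans (⇔-sym (⟦⟧⇔interval σ f e k)) (⇔l e))

    a : Fin m → Arc
    a j = proj₁ (arc j) , suc (proj₁ (proj₂ (arc j)))

    A⇔a : ∀ j e → A j e ⇔ ⟦ a j ⟧ e
    A⇔a j = proj₂ (proj₂ (proj₂ (arc j)))

    deleted : ∀ j → ∃ λ b → Deletes (a j) b ×
              (¬ ⟦ a j ⟧ x → proj₁ (A′.first b) ≡ first (a j) × proj₁ (A′.last b) ≡ last (a j))
    deleted j = delete _ _ (proj₁ (proj₂ (proj₂ (arc j))))

    b : Fin m → A′.Arc
    b j = proj₁ (deleted j)

    deletes : ∀ j → Deletes (a j) (b j)
    deletes j = proj₁ (proj₂ (deleted j))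

    A⇔b : ∀ j y → A j (proj₁ y) ⇔ A′.⟦ b j ⟧ y
    A⇔b j y = ⇔-trans (A⇔a j (proj₁ y)) (⇔-sym (proj₂ (deletes j) y))

    good : A′.Good b
    good {i} {j} i≢j = delete-meets (deletes i) (deletes j) (proj₂ (proj₂ (deleted j)))
      λ a⊆a → antichain i j i≢j λ e e∈i → from (A⇔a j e) (a⊆a e (to (A⇔a i e) e∈i))

    -- `≤-refl` fixes the fuel as the successor of the total length.
    reduced = A′.reduce _ b ≤-refl (λ j → proj₁ (deletes j)) good
    c     = proj₁ reduced
    match = proj₂ (proj₂ reduced)

    pruned = A′.prune m c
    m′     = proj₁ pruned
    φ      = proj₁ (proj₂ pruned)
    match′ = proj₂ (proj₂ (proj₂ (proj₂ pruned)))

    nonempty : ∀ i → 0 < A′.len (c (φ i))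
    nonempty = proj₁ (proj₂ (proj₂ (proj₂ pruned)))

    interval : ∀ i → IsInterval σ′ A′.⟦ c (φ i) ⟧
    interval i with c (φ i) | nonempty i
    ... | f , suc k | _ = f , k , λ e → ⟦⟧⇔interval σ′ f e k

    antichain′ : IsAntichain (A′.⟦_⟧ ∘ c ∘ φ)
    antichain′ i j i≢j =
      proj₁ (proj₂ reduced) (φ i) (φ j) (λ p → i≢j (proj₁ (proj₂ (proj₂ pruned)) p)) (nonempty i)

theorem3p3 : (E : Set) (_≟_ : DecidableEquality E) → Finite E →
    (Ind : SubsetOf E → Set) → IsMultiPath E Ind →
    (x : E) → IsMultiPath (Minus E _≟_ x) (Delete E _≟_ Ind x)
theorem3p3 E _≟_ _ Ind (σ , m , A , intervals , antichain , ind) x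
  with Inverse.to (CyclicPerm.perm σ) x ≟ x
... | yes gx≡x = delete-fixed E _≟_ Ind x σ A intervals antichain ind gx≡x
... | no gx≢x  = delete-moved E _≟_ Ind x σ A intervals antichain ind gx≢x
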